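{- There is a hereditary $3$-graph property which admits zero $\mathrm{vdisc}_3$-error but which is not stable.
   Context: For distinct $x,y,z$ write $xyz=\{x,y,z\}$; $[n]=\{1,\dots,n\}$; $K_3[X,Y,Z]=\{xyz:x\in X,y\in Y,z\in Z\text{ pairwise distinct}\}$. A $3$-graph is a pair $H=(V,F)$ with $F\subseteq\binom V3$. A hereditary $3$-graph property is a class of finite $3$-graphs closed under isomorphism and induced sub-$3$-graphs. An equipartition is a partition whose parts differ in size by at most $1$. Stability: a graph $(W,E)$ has the $k$-order property if there are $a_1,\dots,a_k,b_1,\dots,b_k\in W$ with $a_ib_j\in E$ if and only if $i\leq j$; otherwise it is $k$-stable. For a $3$-graph $H=(V,F)$, $\mathrm{Graph}(H)$ is the bipartite graph with parts $V$ and $\binom V2$ and edges $\{ae:a\in V,e\in\binom V2,\{a\}\cup e\in F\}$. $H$ is $k$-stable if $\mathrm{Graph}(H)$ is $k$-stable; a hereditary $3$-graph property is stable if there is $k$ such that each of its members is $k$-stable. A $3$-partite $3$-graph $(U\cup V\cup W,F)$ with $|F|=d|U||V||W|$ has $\mathrm{vdisc}_3(\epsilon)$ if for all $U'\subseteq U$, $V'\subseteq V$, $W'\subseteq W$, $\big||F\cap K_3[U',V',W']|-d|U'||V'||W'|\big|\leq\epsilon|U||V||W|$. A hereditary $3$-graph property $\mathcal{H}$ admits zero $\mathrm{vdisc}_3$-error if for all $\epsilon>0$ and $t_0\geq1$ there are $T,N$ such that for every $H=(V,F)\in\mathcal{H}$ with $|V|\geq N$ there is an equipartition $\mathcal{P}$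 of $V$ into $t$ parts, $t_0\leq t\leq T$, such that for every three distinct parts $X,Y,Z\in\mathcal{P}$ the $3$-graph $(X\cup Y\cup Z,F\cap K_3[X,Y,Z])$ has $\mathrm{vdisc}_3(\epsilon)$. -}

module Defs where

open import Data.Bool.Properties using () renaming (_≟_ to _≟ᵇ_)
open import Data.Empty using (⊥)
open import Data.Fin using (Fin)
import Data.Fin as Fin
import Data.Fin.Properties as Fin
open import Data.Fin.Subset using (Subset; inside; outside; _∈_; _⊆_; _∪_; _∩_; ⁅_⁆; ∣_∣; Nonempty; Empty)
open import Data.Fin.Subset.Properties using (_∈?_)
open import Data.Integer using (+_)
open import Data.List using (List; []; _∷_; [_]; _++_; map; filter; length)
open import Data.Nat using (ℕ; zero; suc; _*_; _≤_)
open import Data.Product using (Σ-syntax; ∃-syntax; _×_; _,_)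
open import Data.Rational as ℚ using (ℚ; 0ℚ)
open import Data.Sum using (_⊎_; inj₁; inj₂)
open import Data.Vec using ([]; _∷_)
import Data.Vec.Properties as Vec
open import Function.Bundles using (_⇔_)
open import Function.Definitions using (Injective; Bijective)
open import Level using (0ℓ)
open import Relation.Binary.PropositionalEquality using (_≡_; _≢_)
open import Relation.Nullary using (¬_; ¬?)
open import Relation.Nullary.Decidable using (_×-dec_)
open import Relation.Unary using (Pred; Decidable)
open import Relation.Unary.Properties using (_∩?_)

-- Only meaningful as the set xyz when x, y, z are pairwise distinct.
triple : ∀ {n} → Fin n → Fin n → Fin n → Subset n
triple x y z = ⁅ x ⁆ ∪ ⁅ y ⁆ ∪ ⁅ z ⁆

Distinct₃ : ∀ {A : Set} → A → A → A → Set
Distinct₃ x y z = x ≢ y × y ≢ z × x ≢ z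

K₃ : ∀ {n} → Subset n → Subset n → Subset n → Pred (Subset n) 0ℓ
K₃ X Y Z e = ∃[ x ] ∃[ y ] ∃[ z ]
  (x ∈ X × y ∈ Y × z ∈ Z × Distinct₃ x y z × e ≡ triple x y z)

K₃? : ∀ {n} (X Y Z : Subset n) → Decidable (K₃ X Y Z)
K₃? X Y Z e = Fin.any? λ x → Fin.any? λ y → Fin.any? λ z →
  (x ∈? X) ×-dec (y ∈? Y) ×-dec (z ∈? Z) ×-dec
  (¬? (x Fin.≟ y) ×-dec ¬? (y Fin.≟ z) ×-dec ¬? (x Fin.≟ z)) ×-dec
  Vec.≡-dec _≟ᵇ_ e (triple x y z)

-- Each subset of Fin n occurs exactly once.
allSubsets : ∀ n → List (Subset n)
allSubsets zero    = [ [] ]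
allSubsets (suc n) = map (inside ∷_) (allSubsets n) ++ map (outside ∷_) (allSubsets n)

-- Cardinality of a decidable family of subsets of Fin n.
# : ∀ {n} {F : Pred (Subset n) 0ℓ} → Decidable F → ℕ
# {n} F? = length (filter F? (allSubsets n))

-- Finite 3-graphs, with vertex set Fin order.  Properties of 3-graphs are
-- required below to be isomorphism-invariant, so nothing is lost by
-- considering these vertex sets only.
record ThreeGraph : Set₁ where
  field
    order  : ℕ
    F      : Pred (Subset order) 0ℓ
    F?     : Decidable F
    F-size : ∀ {e} → F e → ∣ e ∣ ≡ 3

open ThreeGraph public

PreservesEdges : (G H : ThreeGraph) → (Fin (order G) → Fin (order H)) → Set
PreservesEdges G H f = ∀ x y z → Distinct₃ x y z →
  F G (triple x y z) ⇔ F H (triple (f x) (f y) (f z))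

_≅_ : ThreeGraph → ThreeGraph → Set
G ≅ H = ∃[ f ] (Bijective _≡_ _≡_ f × PreservesEdges G H f)

-- G is (a copy on Fin (order G) of) the sub-3-graph of H induced on the
-- image of f.
_≤ᵢ_ : ThreeGraph → ThreeGraph → Set
G ≤ᵢ H = ∃[ f ] (Injective _≡_ _≡_ f × PreservesEdges G H f)

Property : Set₁
Property = Pred ThreeGraph 0ℓ

record IsHereditary (𝓗 : Property) : Set₁ where
  field
    iso-closed     : ∀ {G H} → G ≅ H → 𝓗 H → 𝓗 G
    induced-closed : ∀ {G H} → G ≤ᵢ H → 𝓗 H → 𝓗 G

record Graph : Set₁ where
  field
    W      : Set
    E      : W → W → Set
    sym    : ∀ {u v} → E u v → E v u
    irrefl : ∀ {v} → ¬ E v v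

OrderProperty : ℕ → Graph → Set
OrderProperty k G =
  Σ[ a ∈ (Fin k → W) ] Σ[ b ∈ (Fin k → W) ] (∀ i j → E (a i) (b j) ⇔ i Fin.≤ j)
  where open Graph G

IsGraphStable : ℕ → Graph → Set
IsGraphStable k G = ¬ OrderProperty k G

VertexPair : ℕ → Set
VertexPair n = Σ[ e ∈ Subset n ] ∣ e ∣ ≡ 2

toGraph : ThreeGraph → Graph
toGraph H = record { W = W ; E = E ; sym = λ {u} {v} → E-sym u v ; irrefl = λ {v} → E-irrefl v }
  where
  W : Set
  W = Fin (order H) ⊎ VertexPair (order H)

  E : W → W → Set
  E (inj₁ a)       (inj₂ (e , _)) = F H (⁅ a ⁆ ∪ e)
  E (inj₂ (e , _)) (inj₁ a)       = F H (⁅ a ⁆ ∪ e)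
  E (inj₁ _)       (inj₁ _)       = ⊥
  E (inj₂ _)       (inj₂ _)       = ⊥

  E-sym : ∀ u v → E u v → E v u
  E-sym (inj₁ _) (inj₂ _) p = p
  E-sym (inj₂ _) (inj₁ _) p = p

  E-irrefl : ∀ v → ¬ E v v
  E-irrefl (inj₁ _) ()
  E-irrefl (inj₂ _) ()

IsThreeGraphStable : ℕ → ThreeGraph → Set
IsThreeGraphStable k H = IsGraphStable k (toGraph H)

IsStable : Property → Set₁
IsStable 𝓗 = ∃[ k ] (∀ H → 𝓗 H → IsThreeGraphStable k H)

fromℕ : ℕ → ℚ
fromℕ n = + n ℚ./ 1

-- The 3-partite 3-graph (U ∪ V ∪ W, F) has vdisc₃(ε); intended for pairwise
-- disjoint U, V, W and F contained in K₃ U V W.  The density d is rational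
-- whenever U, V, W are nonempty, and otherwise its choice is immaterial.
HasVdisc₃ : ∀ {n} → ℚ → (U V W : Subset n) → {F : Pred (Subset n) 0ℓ} → Decidable F → Set
HasVdisc₃ ε U V W F? = ∃[ d ]
  ( fromℕ (# F?) ≡ d ℚ.* fromℕ (∣ U ∣ * ∣ V ∣ * ∣ W ∣)
  × (∀ U′ V′ W′ → U′ ⊆ U → V′ ⊆ V → W′ ⊆ W →
       ℚ.∣ fromℕ (# (F? ∩? K₃? U′ V′ W′)) ℚ.- d ℚ.* fromℕ (∣ U′ ∣ * ∣ V′ ∣ * ∣ W′ ∣) ∣
         ℚ.≤ ε ℚ.* fromℕ (∣ U ∣ * ∣ V ∣ * ∣ W ∣)))

record IsEquipartition {n t : ℕ} (P : Fin t → Subset n) : Set where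
  field
    nonempty : ∀ i → Nonempty (P i)
    disjoint : ∀ i j → i ≢ j → Empty (P i ∩ P j)
    covers   : ∀ v → ∃[ i ] v ∈ P i
    balanced : ∀ i j → ∣ P i ∣ ≤ suc ∣ P j ∣

-- Since vdisc₃(ε) is monotone in ε, rational ε > 0 suffice in place of real ones.
AdmitsZeroVdisc₃Error : Property → Set₁
AdmitsZeroVdisc₃Error 𝓗 =
  ∀ (ε : ℚ) → 0ℚ ℚ.< ε → ∀ (t₀ : ℕ) → 1 ≤ t₀ →
  ∃[ T ] ∃[ N ] (∀ (H : ThreeGraph) → 𝓗 H → N ≤ order H →
    ∃[ t ] (t₀ ≤ t × t ≤ T ×
      Σ[ P ∈ (Fin t → Subset (order H)) ]
        ( IsEquipartition P
        × (∀ i j k → Distinct₃ i j k →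
             HasVdisc₃ ε (P i) (P j) (P k) (F? H ∩? K₃? (P i) (P j) (P k))))))

{-# OPTIONS --safe #-}
-- The property consists of the 3-graphs all of whose edges pass through one
-- common vertex.  Such a 3-graph on n vertices has at most n² edges, which is
-- o(n³), so every equipartition into a fixed number of parts is
-- vdisc₃-regular once n is large.  On the other hand the edges {aᵢ, c, bⱼ}
-- with i ≤ j all contain c, and the vertices aᵢ and pairs {c, bⱼ} realise the
-- order property of every length.
module Submission where

open import Data.Bool using (Bool; true; false; T)
open import Data.Bool.Properties using () renaming (_≟_ to _≟ᵇ_)
open import Data.Fin as Fin using (Fin; zero; suc; toℕ; fromℕ<; combine; _↑ˡ_; _↑ʳ_)
open import Data.Fin.Properties as Fin using (_≟_; toℕ<n; toℕ-fromℕ<; toℕ-injective; splitAt-↑ˡ; splitAt-↑ʳ)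
open import Data.Fin.Subset using (Subset; inside; outside; _∈_; _∉_; _∪_; ⁅_⁆; ∣_∣; Nonempty)
open import Data.Fin.Subset.Properties
  using (x∈⁅x⁆; x∈⁅y⁆⇒x≡y; x≢y⇒x∉⁅y⁆; x∈p∪q⁻; x∈p∪q⁺; x∈p∩q⁻; ∣⁅x⁆∣≡1; ∪-comm; ∪-assoc; p⊆q⇒∣p∣≤∣q∣; ∪-identityˡ)
import Data.Integer as ℤ
import Data.Integer.Properties as ℤ
open import Data.List using (List; []; _∷_; filter; lookup)
open import Data.List.Membership.Propositional.Properties using (∈-lookup; ∈-map⁻)
import Data.List.Relation.Binary.Sublist.Propositional as Sublist
import Data.List.Relation.Binary.Sublist.Propositional.Properties as Sublist
import Data.List.Relation.Unary.All as All
open import Data.List.Relation.Unary.All.Properties using (all-filter)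
open import Data.List.Relation.Unary.AllPairs using ([]; _∷_)
open import Data.List.Relation.Unary.Unique.Propositional using (Unique)
import Data.List.Relation.Unary.Unique.Propositional.Properties as Unique
open import Data.Nat as ℕ using (ℕ; zero; suc; _+_; _*_; _≤_; _<_; z≤n; s≤s; z<s)
import Data.Nat.Properties as ℕ
open import Data.Nat.Tactic.RingSolver using (solve-∀)
open import Data.Product using (Σ-syntax; ∃-syntax; _×_; _,_; proj₁; proj₂)
open import Data.Rational as ℚ using (ℚ; mkℚ; 0ℚ; 1ℚ; toℚᵘ)
import Data.Rational.Properties as ℚ
open import Data.Rational.Unnormalised as ℚᵘ using (mkℚᵘ)
import Data.Rational.Unnormalised.Properties as ℚᵘ
open import Data.Sum using (_⊎_; inj₁; inj₂; [_,_]′)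
open import Data.Vec using ([]; _∷_; tabulate; here; there)
import Data.Vec.Properties as Vec
open import Function using (_∘_; case_of_)
open import Function.Bundles using (Equivalence; mk⇔)
open import Function.Definitions using (Injective)
open import Level using (0ℓ)
open import Relation.Binary.PropositionalEquality
  using (_≡_; _≢_; refl; sym; trans; cong; subst; module ≡-Reasoning)
open import Relation.Nullary using (¬_; Dec; yes; no; does; contradiction)
open import Relation.Nullary.Decidable using (_×-dec_; dec-true)
open import Relation.Unary using (Pred; Decidable)
open import Relation.Unary.Properties using (_∩?_)
open import Algebra.Properties.Group ℚ.+-0-group using (⁻¹-involutive)
open import Defs

-- Counting decidable families of subsets

lookup-injective : ∀ {A : Set} {xs : List A} → Unique xs → Injective _≡_ _≡_ (lookup xs)
lookup-injective (_   ∷ _)  {zero}  {zero}  _  = refl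
lookup-injective (x∉  ∷ _)  {zero}  {suc j} eq = contradiction eq (All.lookup x∉ (∈-lookup j))
lookup-injective (x∉  ∷ _)  {suc i} {zero}  eq = contradiction (sym eq) (All.lookup x∉ (∈-lookup i))
lookup-injective (_   ∷ u)  {suc i} {suc j} eq = cong suc (lookup-injective u eq)

allSubsets-unique : ∀ n → Unique (allSubsets n)
allSubsets-unique zero    = All.[] ∷ []
allSubsets-unique (suc n) =
  Unique.++⁺ (Unique.map⁺ Vec.∷-injectiveʳ (allSubsets-unique n))
             (Unique.map⁺ Vec.∷-injectiveʳ (allSubsets-unique n))
             λ (p , q) → case trans (sym (proj₂ (proj₂ (∈-map⁻ (inside ∷_) p))))
                                    (proj₂ (proj₂ (∈-map⁻ (outside ∷_) q))) of λ ()

module _ {n : ℕ} {F : Pred (Subset n) 0ℓ} (F? : Decidable F) where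

  -- The filtered list repeats nothing, so looking up an index and applying `g` is an injection from
  -- its indices into `Fin m`. Since `g` takes the proof of `F e`, its value may depend on how a set
  -- is presented as an edge; injectivity is therefore asked across arbitrary proofs.
  #-≤-injective : ∀ {m} (g : ∀ {e} → F e → Fin m) →
    (∀ {e e′} (p : F e) (p′ : F e′) → g p ≡ g p′ → e ≡ e′) → # F? ≤ m
  #-≤-injective g g-injective = Fin.injective⇒≤ {f = λ i → g (edge i)} λ {i} {j} eq →
    lookup-injective (Unique.filter⁺ F? (allSubsets-unique n)) (g-injective (edge i) (edge j) eq)
    where
    edge : ∀ i → F (lookup (filter F? (allSubsets n)) i)
    edge i = All.lookup (all-filter F? (allSubsets n)) (∈-lookup i)

  #-mono : ∀ {G : Pred (Subset n) 0ℓ} (G? : Decidable G) → (∀ {e} → F e → G e) → # F? ≤ # G?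
  #-mono G? F⊆G = Sublist.length-mono-≤
    (Sublist.filter⁺ F? G? (λ { refl → F⊆G }) (Sublist.⊆-refl {x = allSubsets n}))

-- Triples

∣⁅x⁆∪p∣ : ∀ {n} (x : Fin n) (p : Subset n) → x ∉ p → ∣ ⁅ x ⁆ ∪ p ∣ ≡ suc ∣ p ∣
∣⁅x⁆∪p∣ zero    (inside  ∷ p) x∉p = contradiction here x∉p
∣⁅x⁆∪p∣ zero    (outside ∷ p) x∉p = cong (suc ∘ ∣_∣) (∪-identityˡ p)
∣⁅x⁆∪p∣ (suc x) (inside  ∷ p) x∉p = cong suc (∣⁅x⁆∪p∣ x p (x∉p ∘ there))
∣⁅x⁆∪p∣ (suc x) (outside ∷ p) x∉p = ∣⁅x⁆∪p∣ x p (x∉p ∘ there)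

module _ {n : ℕ} where

  ∣pair∣ : ∀ {x y : Fin n} → x ≢ y → ∣ ⁅ x ⁆ ∪ ⁅ y ⁆ ∣ ≡ 2
  ∣pair∣ {x} {y} x≢y = trans (∣⁅x⁆∪p∣ x ⁅ y ⁆ (x≢y⇒x∉⁅y⁆ x≢y)) (cong suc (∣⁅x⁆∣≡1 y))

  ∈-triple⁻ : ∀ {v} (x y z : Fin n) → v ∈ triple x y z → v ≡ x ⊎ v ≡ y ⊎ v ≡ z
  ∈-triple⁻ x y z v∈ with x∈p∪q⁻ ⁅ x ⁆ _ v∈
  ... | inj₁ v∈x = inj₁ (x∈⁅y⁆⇒x≡y x v∈x)
  ... | inj₂ v∈yz with x∈p∪q⁻ ⁅ y ⁆ _ v∈yz
  ...   | inj₁ v∈y = inj₂ (inj₁ (x∈⁅y⁆⇒x≡y y v∈y))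
  ...   | inj₂ v∈z = inj₂ (inj₂ (x∈⁅y⁆⇒x≡y z v∈z))

  ∈-tripleˡ : ∀ (x y z : Fin n) → x ∈ triple x y z
  ∈-tripleˡ x y z = x∈p∪q⁺ (inj₁ (x∈⁅x⁆ x))

  ∈-tripleᵐ : ∀ (x y z : Fin n) → y ∈ triple x y z
  ∈-tripleᵐ x y z = x∈p∪q⁺ (inj₂ (x∈p∪q⁺ (inj₁ (x∈⁅x⁆ y))))

  ∈-tripleʳ : ∀ (x y z : Fin n) → z ∈ triple x y z
  ∈-tripleʳ x y z = x∈p∪q⁺ (inj₂ (x∈p∪q⁺ (inj₂ (x∈⁅x⁆ z))))

  ∣triple∣ : ∀ {x y z : Fin n} → Distinct₃ x y z → ∣ triple x y z ∣ ≡ 3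
  ∣triple∣ {x} {y} {z} (x≢y , y≢z , x≢z) = trans (∣⁅x⁆∪p∣ x _ x∉) (cong suc (∣pair∣ y≢z))
    where
    x∉ : x ∉ ⁅ y ⁆ ∪ ⁅ z ⁆
    x∉ x∈ = [ x≢y ∘ x∈⁅y⁆⇒x≡y y , x≢z ∘ x∈⁅y⁆⇒x≡y z ]′ (x∈p∪q⁻ ⁅ y ⁆ _ x∈)

  triple-swap : ∀ (x y z : Fin n) → triple x y z ≡ triple y x z
  triple-swap x y z = begin
    ⁅ x ⁆ ∪ ⁅ y ⁆ ∪ ⁅ z ⁆    ≡⟨ ∪-assoc ⁅ x ⁆ ⁅ y ⁆ ⁅ z ⁆ ⟨
    (⁅ x ⁆ ∪ ⁅ y ⁆) ∪ ⁅ z ⁆  ≡⟨ cong (_∪ ⁅ z ⁆) (∪-comm ⁅ x ⁆ ⁅ y ⁆) ⟩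
    (⁅ y ⁆ ∪ ⁅ x ⁆) ∪ ⁅ z ⁆  ≡⟨ ∪-assoc ⁅ y ⁆ ⁅ x ⁆ ⁅ z ⁆ ⟩
    ⁅ y ⁆ ∪ ⁅ x ⁆ ∪ ⁅ z ⁆    ∎
    where open ≡-Reasoning

  triple-rotate : ∀ (x y z : Fin n) → triple x y z ≡ triple z x y
  triple-rotate x y z =
    trans (cong (⁅ x ⁆ ∪_) (∪-comm ⁅ y ⁆ ⁅ z ⁆)) (triple-swap x z y)

-- Stars

-- The centre is encoded as a predicate with at most one element rather than as
-- a vertex, so that it can be pulled back along any injection, even one whose
-- image misses it.
record IsCentre (H : ThreeGraph) (C : Fin (order H) → Bool) : Set where
  field
    unique : ∀ {u v} → T (C u) → T (C v) → u ≡ v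
    meets  : ∀ x y z → Distinct₃ x y z → F H (triple x y z) → T (C x) ⊎ T (C y) ⊎ T (C z)

Star : Property
Star H = ∃[ C ] IsCentre H C

Star-induced-closed : ∀ {G H} → G ≤ᵢ H → Star H → Star G
Star-induced-closed (f , f-injective , preserves) (C , centre) = C ∘ f , record
  { unique = λ p q → f-injective (unique p q)
  ; meets  = λ x y z xyz@(x≢y , y≢z , x≢z) p → meets (f x) (f y) (f z)
      (x≢y ∘ f-injective , y≢z ∘ f-injective , x≢z ∘ f-injective)
      (Equivalence.to (preserves x y z xyz) p)
  }
  where open IsCentre centre

Star-isHereditary : IsHereditary Star
Star-isHereditary = record
  { iso-closed     = λ {G} {H} (f , (f-injective , _) , preserves) →
      Star-induced-closed {G} {H} (f , f-injective , preserves)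
  ; induced-closed = λ {G} {H} → Star-induced-closed {G} {H}
  }

module _ (H : ThreeGraph) (star : Star H) (X Y Z : Subset (order H)) where
  open IsCentre (proj₂ star)

  private
    n = order H
    C = proj₁ star

    -- Membership in `K₃ X Y Z` supplies distinct vertices to which `meets` applies; the edge is
    -- then reordered so that the centre comes first.
    through-centre : ∀ {e} → F H e × K₃ X Y Z e → ∃[ c ] ∃[ u ] ∃[ v ] (T (C c) × e ≡ triple c u v)
    through-centre (p , x , y , z , _ , _ , _ , xyz , refl) with meets x y z xyz p
    ... | inj₁ Cx        = x , y , z , Cx , refl
    ... | inj₂ (inj₁ Cy) = y , x , z , Cy , triple-swap x y z
    ... | inj₂ (inj₂ Cz) = z , x , y , Cz , triple-rotate x y z

    link : ∀ {e} → F H e × K₃ X Y Z e → Fin (n * n)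
    link p = let (_ , u , v , _) = through-centre p in combine u v

    -- The first vertices of both presentations satisfy `C`, so `unique` identifies them, and the
    -- other two vertices are recovered from the link. The ordered pair `(u , v)` may depend on the
    -- proof, but it always determines the edge.
    link-injective : ∀ {e e′} (p : F H e × K₃ X Y Z e) (p′ : F H e′ × K₃ X Y Z e′) →
      link p ≡ link p′ → e ≡ e′
    link-injective p p′ eq with through-centre p | through-centre p′
    ... | c , u , v , Cc , refl | c′ , u′ , v′ , Cc′ , refl
      with refl ← unique Cc Cc′
      with refl , refl ← Fin.combine-injective u v u′ v′ eq = refl

  Star-#≤ : # (F? H ∩? K₃? X Y Z) ≤ n * n
  Star-#≤ = #-≤-injective (F? H ∩? K₃? X Y Z) link link-injective

-- Instability

module HalfStar (k : ℕ) where

  c : Fin (suc (k + k))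
  c = zero

  a b : Fin k → Fin (suc (k + k))
  a i = suc (i ↑ˡ k)
  b j = suc (k ↑ʳ j)

  a-injective : ∀ {i i′} → a i ≡ a i′ → i ≡ i′
  a-injective = Fin.↑ˡ-injective k _ _ ∘ Fin.suc-injective

  b-injective : ∀ {j j′} → b j ≡ b j′ → j ≡ j′
  b-injective = Fin.↑ʳ-injective k _ _ ∘ Fin.suc-injective

  a≢b : ∀ {i j} → a i ≢ b j
  a≢b {i} {j} eq = case trans (sym (splitAt-↑ˡ k i k))
    (trans (cong (Fin.splitAt k) (Fin.suc-injective eq)) (splitAt-↑ʳ k k j)) of λ ()

  a≢c : ∀ {i} → a i ≢ c
  a≢c ()

  c≢b : ∀ {j} → c ≢ b j
  c≢b ()

  -- With `c` in the middle, the triple is definitionally `⁅ a i ⁆` joined to the pair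
  -- `⁅ c ⁆ ∪ ⁅ b j ⁆`, so adjacency of `a i` to that pair in `toGraph graph` needs no rewriting.
  Edge : Pred (Subset (suc (k + k))) 0ℓ
  Edge e = ∃[ i ] ∃[ j ] (i Fin.≤ j × e ≡ triple (a i) c (b j))

  Edge? : Decidable Edge
  Edge? e = Fin.any? λ i → Fin.any? λ j →
    (i Fin.≤? j) ×-dec Vec.≡-dec _≟ᵇ_ e (triple (a i) c (b j))

  graph : ThreeGraph
  graph = record
    { order  = suc (k + k)
    ; F      = Edge
    ; F?     = Edge?
    ; F-size = λ { (i , j , _ , refl) → ∣triple∣ (a≢c {i} , c≢b {j} , a≢b) }
    }

  C : Fin (suc (k + k)) → Bool
  C zero    = true
  C (suc _) = false

  isStar : Star graph
  isStar = C , record { unique = unique ; meets = meets }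
    where
    unique : ∀ {u v} → T (C u) → T (C v) → u ≡ v
    unique {zero} {zero} _ _ = refl

    meets : ∀ x y z → Distinct₃ x y z → Edge (triple x y z) → T (C x) ⊎ T (C y) ⊎ T (C z)
    meets x y z _ (i , j , _ , eq)
      with ∈-triple⁻ x y z (subst (c ∈_) (sym eq) (∈-tripleᵐ (a i) c (b j)))
    ... | inj₁ refl        = inj₁ _
    ... | inj₂ (inj₁ refl) = inj₂ (inj₁ _)
    ... | inj₂ (inj₂ refl) = inj₂ (inj₂ _)

  -- A triple determines its indices: the vertices `a`, `b` and `c` never coincide across kinds, so
  -- `a i` can only be `a i′` and `b j` only `b j′`.
  edge⇒≤ : ∀ i j → Edge (triple (a i) c (b j)) → i Fin.≤ j
  edge⇒≤ i j (i′ , j′ , i′≤j′ , eq)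
    with ∈-triple⁻ (a i′) c (b j′) (subst (a i ∈_) eq (∈-tripleˡ (a i) c (b j)))
       | ∈-triple⁻ (a i′) c (b j′) (subst (b j ∈_) eq (∈-tripleʳ (a i) c (b j)))
  -- The cases `a i ≡ c` and `b j ≡ c` equate a successor with `zero` and are dismissed by coverage.
  ... | inj₂ (inj₂ aᵢ≡b) | _ = contradiction aᵢ≡b a≢b
  ... | inj₁ _ | inj₁ bⱼ≡a = contradiction (sym bⱼ≡a) a≢b
  ... | inj₁ aᵢ≡a | inj₂ (inj₂ bⱼ≡b)
    with refl ← a-injective aᵢ≡a
    with refl ← b-injective bⱼ≡b = i′≤j′

  hasOrderProperty : OrderProperty k (toGraph graph)
  hasOrderProperty =
      (λ i → inj₁ (a i))
    , (λ j → inj₂ (⁅ c ⁆ ∪ ⁅ b j ⁆ , ∣pair∣ (c≢b {j})))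
    , λ i j → mk⇔ (edge⇒≤ i j) (λ i≤j → i , j , i≤j , refl)

Star-unstable : ¬ IsStable Star
Star-unstable (k , stable) = stable graph isStar hasOrderProperty
  where open HalfStar k

-- Equipartitions

colourClass : ∀ {n t} → (Fin n → Fin t) → Fin t → Subset n
colourClass f i = tabulate λ v → does (f v ≟ i)

module _ {n t : ℕ} (f : Fin n → Fin t) where

  ∈-colourClass⁺ : ∀ v → v ∈ colourClass f (f v)
  ∈-colourClass⁺ v = Vec.lookup⇒[]= v _
    (trans (Vec.lookup∘tabulate _ v) (dec-true (f v ≟ f v) refl))

  ∈-colourClass⁻ : ∀ {v i} → v ∈ colourClass f i → f v ≡ i
  ∈-colourClass⁻ {v} {i} v∈
    with f v ≟ i | trans (sym (Vec.lookup∘tabulate (λ v → does (f v ≟ i)) v)) (Vec.[]=⇒lookup v∈)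
  ... | yes eq | _ = eq

  -- The new vertex goes in front, so a class of `extend c` unfolds to the bit `does (c ≟ i)`
  -- followed by the old class; its size computes once `c ≟ i` is decided.
  extend : Fin t → Fin (suc n) → Fin t
  extend c zero    = c
  extend c (suc v) = f v

  ∣class-extend∣-≡ : ∀ c i → c ≡ i → ∣ colourClass (extend c) i ∣ ≡ suc ∣ colourClass f i ∣
  ∣class-extend∣-≡ c i c≡i with c ≟ i
  ... | yes _  = refl
  ... | no c≢i = contradiction c≡i c≢i

  ∣class-extend∣-≢ : ∀ c i → c ≢ i → ∣ colourClass (extend c) i ∣ ≡ ∣ colourClass f i ∣
  ∣class-extend∣-≢ c i c≢i with c ≟ i
  ... | yes c≡i = contradiction c≡i c≢i
  ... | no _    = refl

-- Colours are assigned cyclically; next is the colour of the vertex to come and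
-- rounds the number of completed rounds.
record CyclicColouring (t n : ℕ) : Set where
  field
    colour : Fin n → Fin t
    rounds : ℕ
    next   : Fin t
    total  : n ≡ toℕ next + rounds * t
    behind : ∀ i → toℕ next ≤ toℕ i → ∣ colourClass colour i ∣ ≡ rounds
    ahead  : ∀ i → toℕ i < toℕ next → ∣ colourClass colour i ∣ ≡ suc rounds

cyclicColouring : ∀ t n → CyclicColouring (suc t) n
cyclicColouring t zero = record
  { colour = λ () ; rounds = 0 ; next = zero ; total = refl ; behind = λ _ _ → refl ; ahead = λ _ () }
cyclicColouring t (suc n) with cyclicColouring t n
... | record { colour = f ; rounds = q ; next = r ; total = total ; behind = behind ; ahead = ahead }
  = step (suc (toℕ r) ℕ.<? suc t)
  where
  -- Only colour `r` gains a vertex, and with it every colour up to `r` has been used in the current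
  -- round. Both cases of `step` read the new sizes off this.
  updated : ∀ i → toℕ i ≤ toℕ r → ∣ colourClass (extend f r) i ∣ ≡ suc q
  updated i i≤r with ℕ.m≤n⇒m<n∨m≡n i≤r
  ... | inj₁ i<r = trans (∣class-extend∣-≢ f r i λ { refl → ℕ.n≮n _ i<r }) (ahead i i<r)
  ... | inj₂ i≡r with refl ← toℕ-injective i≡r =
    trans (∣class-extend∣-≡ f i i refl) (cong suc (behind i ℕ.≤-refl))

  step : Dec (suc (toℕ r) < suc t) → CyclicColouring (suc t) (suc n)
  step (yes r+1<t) = record
    { colour = extend f r
    ; rounds = q
    ; next   = fromℕ< r+1<t
    ; total  = trans (cong suc total) (cong (_+ q * suc t) (sym next≡))
    ; behind = λ i r<i → let r<i′ = subst (_≤ toℕ i) next≡ r<i in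
        trans (∣class-extend∣-≢ f r i λ { refl → ℕ.n≮n _ r<i′ }) (behind i (ℕ.<⇒≤ r<i′))
    ; ahead  = λ i i<r → updated i (ℕ.≤-pred (subst (toℕ i <_) next≡ i<r))
    }
    where
    next≡ : toℕ (fromℕ< r+1<t) ≡ suc (toℕ r)
    next≡ = toℕ-fromℕ< r+1<t
  -- Here `r` is the last colour, so the round closes: `updated` covers all colours, and
  -- `suc t + q * suc t` is `suc q * suc t` by definition.
  step (no r+1≮t) = record
    { colour = extend f r
    ; rounds = suc q
    ; next   = zero
    ; total  = trans (cong suc total) (cong (λ m → suc m + q * suc t) r≡t)
    ; behind = λ i _ → updated i (subst (toℕ i ≤_) (sym r≡t) (ℕ.≤-pred (toℕ<n i)))
    ; ahead  = λ _ ()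
    }
    where
    r≡t : toℕ r ≡ t
    r≡t = ℕ.≤-antisym (ℕ.≤-pred (toℕ<n r)) (ℕ.≤-pred (ℕ.≮⇒≥ r+1≮t))

∣p∣>0⇒Nonempty : ∀ {n} (p : Subset n) → 0 < ∣ p ∣ → Nonempty p
∣p∣>0⇒Nonempty (inside  ∷ p) _   = zero , here
∣p∣>0⇒Nonempty (outside ∷ p) 0<p = let (x , x∈p) = ∣p∣>0⇒Nonempty p 0<p in suc x , there x∈p

module _ {t n : ℕ} (κ : CyclicColouring t n) where
  open CyclicColouring κ

  private
    P : Fin t → Subset n
    P = colourClass colour

  class-size : ∀ i → ∣ P i ∣ ≡ rounds ⊎ ∣ P i ∣ ≡ suc rounds
  class-size i with toℕ next ℕ.≤? toℕ i
  ... | yes r≤i = inj₁ (behind i r≤i)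
  ... | no  r≰i = inj₂ (ahead i (ℕ.≰⇒> r≰i))

  rounds≤class : ∀ i → rounds ≤ ∣ P i ∣
  rounds≤class i with class-size i
  ... | inj₁ eq = ℕ.≤-reflexive (sym eq)
  ... | inj₂ eq = ℕ.≤-trans (ℕ.n≤1+n _) (ℕ.≤-reflexive (sym eq))

  class≤1+rounds : ∀ i → ∣ P i ∣ ≤ suc rounds
  class≤1+rounds i with class-size i
  ... | inj₁ eq = ℕ.≤-trans (ℕ.≤-reflexive eq) (ℕ.n≤1+n _)
  ... | inj₂ eq = ℕ.≤-reflexive eq

  -- The unfinished round holds `toℕ next < t` vertices. This turns a lower bound on the order into
  -- one on `rounds`, hence on every class size.
  order<[1+rounds]*t : n < suc rounds * t
  order<[1+rounds]*t = subst (_< suc rounds * t) (sym total) (ℕ.+-monoˡ-< (rounds * t) (toℕ<n next))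

  isEquipartition : 0 < rounds → IsEquipartition P
  isEquipartition 0<q = record
    { nonempty = λ i → ∣p∣>0⇒Nonempty (P i) (ℕ.≤-trans 0<q (rounds≤class i))
    ; disjoint = λ i j i≢j (v , v∈) → let (v∈i , v∈j) = x∈p∩q⁻ (P i) (P j) v∈ in
        i≢j (trans (sym (∈-colourClass⁻ colour v∈i)) (∈-colourClass⁻ colour v∈j))
    ; covers   = λ v → colour v , ∈-colourClass⁺ colour v
    ; balanced = λ i j → ℕ.≤-trans (class≤1+rounds i) (s≤s (rounds≤class j))
    }

-- Sparse 3-graphs have vdisc₃

-- Passing to unnormalised rationals removes the gcd reduction inside `fromℕ`, so that inequalities
-- become integer cross-multiplications.
toℚᵘ-fromℕ : ∀ m → toℚᵘ (fromℕ m) ℚᵘ.≃ mkℚᵘ (ℤ.+ m) 0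
toℚᵘ-fromℕ m = ℚ.toℚᵘ-fromℚᵘ (mkℚᵘ (ℤ.+ m) 0)

fromℕ-mono : ∀ {m n} → m ≤ n → fromℕ m ℚ.≤ fromℕ n
fromℕ-mono {m} {n} m≤n = ℚ.toℚᵘ-cancel-≤ (begin
  toℚᵘ (fromℕ m)    ≃⟨ toℚᵘ-fromℕ m ⟩
  mkℚᵘ (ℤ.+ m) 0    ≤⟨ ℚᵘ.*≤* (ℤ.*-monoʳ-≤-nonNeg (ℤ.+ 1) (ℤ.+≤+ m≤n)) ⟩
  mkℚᵘ (ℤ.+ n) 0    ≃⟨ toℚᵘ-fromℕ n ⟨
  toℚᵘ (fromℕ n)    ∎)
  where open ℚᵘ.≤-Reasoning

0≤fromℕ : ∀ m → 0ℚ ℚ.≤ fromℕ m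
0≤fromℕ m = fromℕ-mono {0} {m} z≤n

-- A positive rational has numerator at least 1, so it is at least the reciprocal of its
-- denominator.
fromℕ≤ε*fromℕ : ∀ ε → 0ℚ ℚ.< ε → ∀ {m s} → m * ℚ.↧ₙ ε ≤ s → fromℕ m ℚ.≤ ε ℚ.* fromℕ s
fromℕ≤ε*fromℕ (mkℚ (ℤ.+ zero)   d _) (ℚ.*<* (ℤ.+<+ ()))
fromℕ≤ε*fromℕ (mkℚ ℤ.-[1+ _ ]   d _) (ℚ.*<* ())
fromℕ≤ε*fromℕ ε@(mkℚ (ℤ.+ suc p) d _) _ {m} {s} md≤s = ℚ.toℚᵘ-cancel-≤ (begin
  toℚᵘ (fromℕ m)                    ≃⟨ toℚᵘ-fromℕ m ⟩
  mkℚᵘ (ℤ.+ m) 0                    ≤⟨ ℚᵘ.*≤* cross ⟩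
  toℚᵘ ε ℚᵘ.* mkℚᵘ (ℤ.+ s) 0        ≃⟨ ℚᵘ.*-congˡ {toℚᵘ ε} (toℚᵘ-fromℕ s) ⟨
  toℚᵘ ε ℚᵘ.* toℚᵘ (fromℕ s)        ≃⟨ ℚ.toℚᵘ-homo-* ε (fromℕ s) ⟨
  toℚᵘ (ε ℚ.* fromℕ s)              ∎)
  where
  open ℚᵘ.≤-Reasoning
  cross : ℤ.+ m ℤ.* ℤ.+ (suc d * 1) ℤ.≤ (ℤ.+ suc p ℤ.* ℤ.+ s) ℤ.* ℤ.+ 1
  cross rewrite ℕ.*-identityʳ d | ℤ.*-identityʳ (ℤ.+ suc p ℤ.* ℤ.+ s)
    | sym (ℤ.pos-* m (suc d)) | sym (ℤ.pos-* (suc p) s) =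
    ℤ.+≤+ (ℕ.≤-trans md≤s (ℕ.m≤m+n s (p * s)))

∣p-q∣≤ : ∀ {p q m} → 0ℚ ℚ.≤ p → p ℚ.≤ m → 0ℚ ℚ.≤ q → q ℚ.≤ m → ℚ.∣ p ℚ.- q ∣ ℚ.≤ m
∣p-q∣≤ {p} {q} {m} 0≤p p≤m 0≤q q≤m with ℚ.∣p∣≡p∨∣p∣≡-p (p ℚ.- q)
... | inj₁ eq = begin
  ℚ.∣ p ℚ.- q ∣  ≡⟨ eq ⟩
  p ℚ.- q        ≤⟨ ℚ.+-mono-≤ p≤m (ℚ.neg-antimono-≤ 0≤q) ⟩
  m ℚ.+ 0ℚ       ≡⟨ ℚ.+-identityʳ m ⟩
  m              ∎
  where open ℚ.≤-Reasoning
... | inj₂ eq = begin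
  ℚ.∣ p ℚ.- q ∣          ≡⟨ eq ⟩
  ℚ.- (p ℚ.- q)          ≡⟨ ℚ.neg-distrib-+ p (ℚ.- q) ⟩
  ℚ.- p ℚ.+ ℚ.- (ℚ.- q)  ≡⟨ cong (ℚ.- p ℚ.+_) (⁻¹-involutive q) ⟩
  ℚ.- p ℚ.+ q            ≤⟨ ℚ.+-mono-≤ (ℚ.neg-antimono-≤ 0≤p) q≤m ⟩
  0ℚ ℚ.+ m               ≡⟨ ℚ.+-identityˡ m ⟩
  m                      ∎
  where open ℚ.≤-Reasoning

-- Take `d` to be the true density. For any subsets, both the edge count and `d` times the volume
-- lie between 0 and `# F?`, so they differ by at most `# F?`, which sparsity bounds.
hasVdisc₃-sparse : ∀ {n} ε (U V W : Subset n) {F : Pred (Subset n) 0ℓ} (F? : Decidable F) →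
  0 < ∣ U ∣ * ∣ V ∣ * ∣ W ∣ →
  fromℕ (# F?) ℚ.≤ ε ℚ.* fromℕ (∣ U ∣ * ∣ V ∣ * ∣ W ∣) →
  HasVdisc₃ ε U V W F?
hasVdisc₃-sparse ε U V W F? 0<S sparse = d , sym d*S≡A , λ U′ V′ W′ U′⊆U V′⊆V W′⊆W →
  let S′≤S = ℕ.*-mono-≤ (ℕ.*-mono-≤ (p⊆q⇒∣p∣≤∣q∣ U′⊆U) (p⊆q⇒∣p∣≤∣q∣ V′⊆V)) (p⊆q⇒∣p∣≤∣q∣ W′⊆W)
      S′   = ∣ U′ ∣ * ∣ V′ ∣ * ∣ W′ ∣
  in ℚ.≤-trans
    (∣p-q∣≤ (0≤fromℕ (# (F? ∩? K₃? U′ V′ W′)))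
            (fromℕ-mono (#-mono (F? ∩? K₃? U′ V′ W′) F? proj₁))
            (subst (ℚ._≤ d ℚ.* fromℕ S′) (ℚ.*-zeroʳ d) (ℚ.*-monoˡ-≤-nonNeg d (0≤fromℕ S′)))
            (subst (d ℚ.* fromℕ S′ ℚ.≤_) d*S≡A (ℚ.*-monoˡ-≤-nonNeg d (fromℕ-mono S′≤S))))
    sparse
  where
  S = ∣ U ∣ * ∣ V ∣ * ∣ W ∣
  A = # F?

  instance
    S-positive : ℚ.Positive (fromℕ S)
    S-positive = ℚ.positive (ℚ.<-≤-trans (ℚ.*<* (ℤ.+<+ z<s)) (fromℕ-mono 0<S))
    S-nonZero : ℚ.NonZero (fromℕ S)
    S-nonZero = ℚ.pos⇒nonZero (fromℕ S)

  d : ℚ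
  d = fromℕ A ℚ.* ℚ.1/ fromℕ S

  instance
    d-nonNegative : ℚ.NonNegative d
    d-nonNegative = ℚ.nonNeg*nonNeg⇒nonNeg (fromℕ A) {{ℚ.nonNegative (0≤fromℕ A)}}
      (ℚ.1/ fromℕ S) {{ℚ.pos⇒nonNeg (ℚ.1/ fromℕ S) {{ℚ.1/pos⇒pos (fromℕ S)}}}}

  d*S≡A : d ℚ.* fromℕ S ≡ fromℕ A
  d*S≡A = begin
    fromℕ A ℚ.* ℚ.1/ fromℕ S ℚ.* fromℕ S    ≡⟨ ℚ.*-assoc (fromℕ A) (ℚ.1/ fromℕ S) (fromℕ S) ⟩
    fromℕ A ℚ.* (ℚ.1/ fromℕ S ℚ.* fromℕ S)  ≡⟨ cong (fromℕ A ℚ.*_) (ℚ.*-inverseˡ (fromℕ S)) ⟩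
    fromℕ A ℚ.* 1ℚ                          ≡⟨ ℚ.*-identityʳ (fromℕ A) ⟩
    fromℕ A                                 ∎
    where open ≡-Reasoning

-- Zero `vdisc₃`-error for stars

-- Since `q` is at least 1, `n < (q + 1)t ≤ 2qt`; squaring leaves `q²` times a constant in `t` and
-- `δ`, and `q` absorbs that constant.
square-bound : ∀ {n t q δ} → n < suc q * t → 0 < q → (2 * t) * (2 * t) * δ ≤ q → n * n * δ ≤ q * q * q
square-bound {n} {t} {q} {δ} n<[1+q]t 0<q large = begin
  n * n * δ                          ≤⟨ ℕ.*-monoˡ-≤ δ (ℕ.*-mono-≤ n≤2qt n≤2qt) ⟩
  (q + q) * t * ((q + q) * t) * δ    ≡⟨ rearrange q t δ ⟩
  q * q * ((2 * t) * (2 * t) * δ)    ≤⟨ ℕ.*-monoʳ-≤ (q * q) large ⟩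
  q * q * q                          ∎
  where
  open ℕ.≤-Reasoning
  n≤2qt : n ≤ (q + q) * t
  n≤2qt = ℕ.≤-trans (ℕ.<⇒≤ n<[1+q]t) (ℕ.*-monoˡ-≤ t (ℕ.+-monoˡ-≤ q 0<q))
  rearrange : ∀ q t δ → (q + q) * t * ((q + q) * t) * δ ≡ q * q * ((2 * t) * (2 * t) * δ)
  rearrange = solve-∀

Star-admitsZeroVdisc₃Error : AdmitsZeroVdisc₃Error Star
-- Exactly `t₀` parts always suffice, so `T` is `t₀` itself.
Star-admitsZeroVdisc₃Error ε 0<ε t@(suc t′) _ = t , suc K * t , λ H star N≤n →
  let κ      = cyclicColouring t′ (order H)
      open CyclicColouring κ renaming (rounds to q)
      n<     = order<[1+rounds]*t κ
      -- From `(K + 1)t ≤ n < (q + 1)t`, cancel `t`. The extra 1 in the threshold makes the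
      -- inequality strict, which also gives `0 < q`.
      K<q    = ℕ.≤-pred (ℕ.*-cancelʳ-< t (suc K) (suc q) (ℕ.≤-<-trans N≤n n<))
      0<q    = ℕ.≤-<-trans z≤n K<q
      P      = colourClass colour
      ∣P∣≥q  = rounds≤class κ
  in t , ℕ.≤-refl , ℕ.≤-refl , P , isEquipartition κ 0<q , λ i j k _ →
    let S≥q³ = ℕ.*-mono-≤ (ℕ.*-mono-≤ (∣P∣≥q i) (∣P∣≥q j)) (∣P∣≥q k)
    in hasVdisc₃-sparse ε (P i) (P j) (P k) (F? H ∩? K₃? (P i) (P j) (P k))
         (ℕ.<-≤-trans (ℕ.*-mono-< {0} {q * q} {0} {q} (ℕ.*-mono-< {0} {q} {0} {q} 0<q 0<q) 0<q) S≥q³)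
         (ℚ.≤-trans (fromℕ-mono {n = order H * order H} (Star-#≤ H star (P i) (P j) (P k)))
           (fromℕ≤ε*fromℕ ε 0<ε {order H * order H} {∣ P i ∣ * ∣ P j ∣ * ∣ P k ∣}
             (ℕ.≤-trans (square-bound {t = t} {q} {ℚ.↧ₙ ε} n< 0<q (ℕ.<⇒≤ K<q)) S≥q³)))
  where
  -- The constant to be absorbed in `square-bound`, with `δ` the denominator of `ε`.
  K = (2 * t) * (2 * t) * ℚ.↧ₙ ε

proposition2p37 : Σ[ 𝓗 ∈ Property ] (IsHereditary 𝓗 × AdmitsZeroVdisc₃Error 𝓗 × ¬ IsStable 𝓗)
proposition2p37 = Star , Star-isHereditary , Star-admitsZeroVdisc₃Error , Star-unstable
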